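{- Let $\alpha\in\mathbb Q\cap(1,\infty)$ with regular continued fraction expansion $\alpha=[a_1,a_2,\ldots,a_n]$. (1) If $a_1=1$, then $\mathcal{S}_{\mathfrak{i}(\alpha)}(q)=\mathcal{S}^\vee_{\frac{(a_2+1)(\alpha-1)+\alpha-2}{\alpha-1}}(q)$. (2) If $a_1\ge 2$, then $\mathcal{S}_{\mathfrak{i}(\alpha)}(q)=\mathcal{S}^\vee_{\frac{a_1(\alpha-1)+\alpha-2}{\alpha-1}}(q)$.
   Context: A regular continued fraction $[a_1,\ldots,a_n]$ denotes $a_1+\cfrac{1}{a_2+\cfrac{1}{\ddots+\cfrac{1}{a_n}}}$ with $a_1\in\mathbb Z$, $a_2,\ldots,a_n$ positive integers. For an integer $c$, $[c]_q=\frac{1-q^c}{1-q}$. Every rational $\alpha>1$ has a unique negative continued fraction expansion $\alpha=c_1-\cfrac{1}{c_2-\cfrac{1}{\ddots-\cfrac{1}{c_l}}}$ with integers $c_j\ge 2$. Put $M^-_q(c)=\begin{pmatrix}[c]_q & -q^{c-1}\\ 1 & 0\end{pmatrix}$ and define $\mathcal{R}_\alpha(q),\mathcal{S}_\alpha(q)$ by $\begin{pmatrix}\mathcal{R}_\alpha(q)\\ \mathcal{S}_\alpha(q)\end{pmatrix}=M^-_q(c_1)\cdots M^-_q(c_l)\begin{pmatrix}1\\0\end{pmatrix}$; for rational $\alpha\le1$ they are defined recursively by $\mathcal{S}_\alpha=\mathcal{S}_{\alpha+1}$, $\mathcal{R}_\alpha=q^{ -1}(\mathcal{R}_{\alpha+1}-\mathcal{S}_{\alpha+1})$.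 For a nonzero polynomial $f$, $f^\vee(q)=q^{\deg f}f(q^{ -1})$. For $\alpha=\frac{x}{a}>1$ in lowest terms, $\mathfrak{i}(\alpha)=\frac{x}{x-a}$. -}

module Defs where

open import Data.Nat as ℕ using (ℕ; zero; suc; _∸_)
open import Data.Integer as ℤ using (ℤ; +_; -[1+_]; +[1+_])
open import Data.Rational as ℚ using (ℚ; mkℚ; ↥_; ↧ₙ_; 0ℚ; 1ℚ; 1/_)
open import Data.Rational.Properties using (_<?_)
open import Data.List using (List; []; _∷_; map; reverse; replicate; foldr)
open import Data.Product using (_×_; _,_; proj₁; proj₂)
open import Relation.Nullary using (yes; no)

-- Polynomials in q with integer coefficients, as coefficient lists
-- (constant term first).  Two lists denote the same polynomial iff
-- they agree after `strip` (removal of trailing zero coefficients).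

Poly : Set
Poly = List ℤ

strip : Poly → Poly
strip [] = []
strip (a ∷ f) with strip f
... | b ∷ g = a ∷ b ∷ g
... | [] with a
...   | + 0 = []
...   | a′  = a′ ∷ []

_⊕_ : Poly → Poly → Poly
[] ⊕ g = g
(a ∷ f) ⊕ [] = a ∷ f
(a ∷ f) ⊕ (b ∷ g) = (a ℤ.+ b) ∷ (f ⊕ g)

_⊗_ : Poly → Poly → Poly
[] ⊗ g = []
(a ∷ f) ⊗ g = map (a ℤ.*_) g ⊕ (+ 0 ∷ (f ⊗ g))

neg : Poly → Poly
neg = map (λ z → ℤ.- z)

shiftBy : ℕ → Poly → Poly
shiftBy zero f = f
shiftBy (suc k) f = + 0 ∷ shiftBy k f

qint : ℕ → Poly
qint c = replicate c (+ 1)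

-- f^∨(q) = q^(deg f) f(q^(-1)), i.e. the reversal of the coefficient
-- list of f (with trailing zeros removed); result again stripped.
vee : Poly → Poly
vee f = strip (reverse (strip f))

-- The matrix  M⁻_q(c) = ( [c]_q , -q^(c-1) ; 1 , 0 )  acting on a
-- column vector (r , s) gives ( [c]_q r - q^(c-1) s , r ).

applyM : ℕ → Poly × Poly → Poly × Poly
applyM c (r , s) = ((qint c ⊗ r) ⊕ neg (shiftBy (c ∸ 1) s)) , r

RSof : List ℕ → Poly × Poly
RSof cs = foldr applyM ((+ 1 ∷ []) , []) cs

-- Negative continued fraction of x/a > 1 (a ≥ 1):
--   c = ⌈x/a⌉, r = c·a - x; stop if r = 0, else continue with a/r.
-- Denominators strictly decrease, so fuel = a suffices.

negCFfuel : ℕ → ℕ → ℕ → List ℕ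
negCFfuel zero x a = []
negCFfuel (suc f) x zero = []
negCFfuel (suc f) x (suc a′) with (suc a′ ℕ.* ((x ℕ.+ a′) ℕ./ suc a′)) ∸ x
... | zero  = ((x ℕ.+ a′) ℕ./ suc a′) ∷ []
... | suc r = ((x ℕ.+ a′) ℕ./ suc a′) ∷ negCFfuel f (suc a′) (suc r)

negCF : ℕ → ℕ → List ℕ
negCF x a = negCFfuel a x a

Sgt : ℕ → ℕ → Poly
Sgt x a = proj₂ (RSof (negCF x a))

-- 𝒮_α for arbitrary rational α: for α > 1 from the negative continued
-- fraction; for α ≤ 1 via 𝒮_α = 𝒮_{α+1}, i.e. 𝒮_α = 𝒮_{α+k} with
-- k = 2 - ⌈α⌉ the least integer such that α + k > 1.
𝒮 : ℚ → Poly
𝒮 α with 1ℚ <? α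
... | yes _ = Sgt ℤ.∣ ↥ α ∣ (↧ₙ α)
... | no  _ = Sgt ℤ.∣ ↥ β ∣ (↧ₙ β)
  where
  β : ℚ
  β = α ℚ.+ ((ℤ.+ 2 ℤ.- ℚ.⌈ α ⌉) ℚ./ 1)

-- total inverse (value at 0 irrelevant; only used on nonzero arguments)
inv : ℚ → ℚ
inv (mkℚ (+ 0) d c) = 0ℚ
inv p@(mkℚ +[1+ n ] d c) = 1/ p
inv p@(mkℚ -[1+ n ] d c) = 1/ p

-- division (only used with nonzero divisor)
_÷′_ : ℚ → ℚ → ℚ
p ÷′ r = p ℚ.* inv r

ι : ℤ → ℚ
ι z = z ℚ./ 1

cfVal : ℤ → List ℕ → ℚ
cfVal a₁ [] = ι a₁
cfVal a₁ (b ∷ bs) = ι a₁ ℚ.+ inv (cfVal (+ b) bs)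

𝔦 : ℚ → ℚ
𝔦 α = ι (↥ α) ÷′ ι (↥ α ℤ.- + (↧ₙ α))

{-# OPTIONS --safe #-}
-- Modulo ℤ, the argument on the right is −𝔦(α), and 𝒮 has period 1, so the claim is 𝒮₋ₚ = 𝒮ₚ^∨.
-- With p = x/D, r = ⌈p⌉D − x and s = D − r, this says that ℛ at D/r and ℛ at D/s are reversals of
-- each other.  The pair (r, s) is built by the subtractive Euclidean algorithm: adding r to s
-- raises the first negative continued fraction coefficient of (r+s)/r by one and puts a 2 in front of the
-- expansion of (r+s)/s.  The invariant that survives both moves is
--   ℛ = 𝒮 + rev 𝒮′ ,  ℛ′ = 𝒮′ + rev 𝒮 ,
-- where rev reverses with respect to the common degree of ℛ and ℛ′.
module Submission where

open import Defs
open import Data.Nat as ℕ using (ℕ; zero; suc; s≤s; z≤n; _+_; _*_; _<_; _≤_; _∸_; _/_)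
import Data.Nat.Properties as ℕₚ
open import Data.Nat.Coprimality using (Coprime; recompute; 1-coprimeTo)
import Data.Nat.Coprimality as Coprimality
open import Data.Nat.DivMod using (m≡m%n+[m/n]*n; m%n<n; m≥n⇒m/n>0)
open import Data.Nat.Tactic.RingSolver using (solve-∀)
open import Data.Integer as ℤ using (ℤ; +_)
import Data.Integer.Properties as ℤₚ
open import Data.Integer.DivMod using (a≡a%n+[a/n]*n; n%d<d)
open import Data.Integer.Divisibility.Signed using (∣ᵤ⇒∣; ∣⇒∣ᵤ; ∣m+n∣n⇒∣m; ∣n⇒∣m*n)
open import Data.Integer.Tactic.RingSolver using () renaming (solve-∀ to solve-ℤ-∀)
open import Data.Rational as ℚ using (ℚ; mkℚ; 0ℚ; 1ℚ; ↥_; ↧_; ↧ₙ_; *<*)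
import Data.Rational.Properties as ℚₚ
import Data.Rational.Unnormalised as ℚᵘ
open import Data.Rational.Solver using (module +-*-Solver)
open import Data.List using (List; []; _∷_; _++_; map; reverse; length)
open import Data.List.Properties using (unfold-reverse; reverse-++; reverse-involutive; length-reverse; length-++; map-cong; map-id)
open import Data.List.Relation.Unary.All using (All)
open import Data.Empty using (⊥-elim)
open import Data.Product using (_×_; _,_; proj₁; proj₂; ∃-syntax)
open import Relation.Binary.Bundles using (Setoid)
open import Relation.Binary.Definitions using (tri<; tri≈; tri>)
open import Relation.Binary.PropositionalEquality
import Relation.Binary.Reasoning.Setoid as SetoidReasoning
open import Relation.Nullary using (yes; no)
open ≡-Reasoning

-- Polynomials up to equality of all coefficients.

coeff : Poly → ℕ → ℤ
coeff []      n       = + 0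
coeff (a ∷ f) zero    = a
coeff (a ∷ f) (suc n) = coeff f n

-- A record rather than a Π-type, so that f and g are inferable from f ≈ g.
infix 4 _≈_
record _≈_ (f g : Poly) : Set where
  constructor pointwise
  field
    at : ∀ n → coeff f n ≡ coeff g n
open _≈_

≈-setoid : Setoid _ _
≈-setoid = record
  { Carrier = Poly
  ; _≈_ = _≈_
  ; isEquivalence = record
    { refl  = pointwise λ _ → refl
    ; sym   = λ e → pointwise λ n → sym (at e n)
    ; trans = λ e e′ → pointwise λ n → trans (at e n) (at e′ n)
    }
  }

open Setoid ≈-setoid using () renaming (refl to ≈-refl; sym to ≈-sym; trans to ≈-trans; reflexive to ≡⇒≈)
module ≈-Reasoning = SetoidReasoning ≈-setoid

coeff-⊕ : ∀ f g n → coeff (f ⊕ g) n ≡ coeff f n ℤ.+ coeff g n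
coeff-⊕ []      g       n       = sym (ℤₚ.+-identityˡ _)
coeff-⊕ (a ∷ f) []      n       = sym (ℤₚ.+-identityʳ _)
coeff-⊕ (a ∷ f) (b ∷ g) zero    = refl
coeff-⊕ (a ∷ f) (b ∷ g) (suc n) = coeff-⊕ f g n

coeff-neg : ∀ f n → coeff (neg f) n ≡ ℤ.- coeff f n
coeff-neg []      n       = refl
coeff-neg (a ∷ f) zero    = refl
coeff-neg (a ∷ f) (suc n) = coeff-neg f n

∷-cong : ∀ {a f g} → f ≈ g → a ∷ f ≈ a ∷ g
∷-cong f≈g = pointwise λ { zero → refl ; (suc n) → at f≈g n }

tail-cong : ∀ {a b f g} → a ∷ f ≈ b ∷ g → f ≈ g
tail-cong f≈g = pointwise λ n → at f≈g (suc n)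

tail-≈[] : ∀ {a f} → a ∷ f ≈ [] → f ≈ []
tail-≈[] f≈ = pointwise λ n → at f≈ (suc n)

⊕-cong : ∀ {f f′ g g′} → f ≈ f′ → g ≈ g′ → f ⊕ g ≈ f′ ⊕ g′
⊕-cong {f} {f′} {g} {g′} f≈ g≈ = pointwise λ n → begin
  coeff (f ⊕ g) n              ≡⟨ coeff-⊕ f g n ⟩
  coeff f n ℤ.+ coeff g n      ≡⟨ cong₂ ℤ._+_ (at f≈ n) (at g≈ n) ⟩
  coeff f′ n ℤ.+ coeff g′ n    ≡⟨ coeff-⊕ f′ g′ n ⟨
  coeff (f′ ⊕ g′) n            ∎

⊕-assoc : ∀ f g h → (f ⊕ g) ⊕ h ≈ f ⊕ (g ⊕ h)
⊕-assoc f g h = pointwise λ n → begin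
  coeff ((f ⊕ g) ⊕ h) n                        ≡⟨ coeff-⊕ (f ⊕ g) h n ⟩
  coeff (f ⊕ g) n ℤ.+ coeff h n                ≡⟨ cong (λ z → z ℤ.+ coeff h n) (coeff-⊕ f g n) ⟩
  coeff f n ℤ.+ coeff g n ℤ.+ coeff h n        ≡⟨ ℤₚ.+-assoc (coeff f n) _ _ ⟩
  coeff f n ℤ.+ (coeff g n ℤ.+ coeff h n)      ≡⟨ cong (λ z → coeff f n ℤ.+ z) (coeff-⊕ g h n) ⟨
  coeff f n ℤ.+ coeff (g ⊕ h) n                ≡⟨ coeff-⊕ f (g ⊕ h) n ⟨
  coeff (f ⊕ (g ⊕ h)) n                        ∎

⊕-identityʳ : ∀ f → f ⊕ [] ≡ f
⊕-identityʳ []      = refl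
⊕-identityʳ (a ∷ f) = refl

⊕-comm : ∀ f g → f ⊕ g ≡ g ⊕ f
⊕-comm []      g       = sym (⊕-identityʳ g)
⊕-comm (a ∷ f) []      = refl
⊕-comm (a ∷ f) (b ∷ g) = cong₂ _∷_ (ℤₚ.+-comm a b) (⊕-comm f g)

neg-cong : ∀ {f g} → f ≈ g → neg f ≈ neg g
neg-cong {f} {g} f≈g = pointwise λ n →
  trans (coeff-neg f n) (trans (cong ℤ.-_ (at f≈g n)) (sym (coeff-neg g n)))

⊕-inverseʳ : ∀ f → f ⊕ neg f ≈ []
⊕-inverseʳ f = pointwise λ n → begin
  coeff (f ⊕ neg f) n                    ≡⟨ coeff-⊕ f (neg f) n ⟩
  coeff f n ℤ.+ coeff (neg f) n          ≡⟨ cong (λ z → coeff f n ℤ.+ z) (coeff-neg f n) ⟩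
  coeff f n ℤ.- coeff f n                ≡⟨ ℤₚ.+-inverseʳ (coeff f n) ⟩
  + 0                                    ∎

map-1* : ∀ f → map (+ 1 ℤ.*_) f ≡ f
map-1* f = trans (map-cong ℤₚ.*-identityˡ f) (map-id f)

0∷[]≈[] : + 0 ∷ [] ≈ []
0∷[]≈[] = pointwise λ { zero → refl ; (suc _) → refl }

∷ʳ0≈ : ∀ f → f ++ + 0 ∷ [] ≈ f
∷ʳ0≈ []      = 0∷[]≈[]
∷ʳ0≈ (a ∷ f) = ∷-cong (∷ʳ0≈ f)

-- Stripped lists as normal forms, and reversal.

strip-≈[] : ∀ {f} → f ≈ [] → strip f ≡ []
strip-≈[] {[]}    f≈ = refl
strip-≈[] {a ∷ f} f≈ with strip f | strip-≈[] (tail-≈[] f≈) | a | at f≈ 0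
... | [] | refl | .(+ 0) | refl = refl

-- `strip` selects one list from each class of `≈`, so the propositional equalities of the theorem
-- can be proved coefficientwise.
strip-cong : ∀ {f g} → f ≈ g → strip f ≡ strip g
strip-cong {[]}    {g}     f≈g = sym (strip-≈[] (≈-sym f≈g))
strip-cong {a ∷ f} {[]}    f≈g = strip-≈[] f≈g
strip-cong {a ∷ f} {b ∷ g} f≈g
  with strip f | strip g | strip-cong (tail-cong f≈g) | b | at f≈g 0
... | []    | _ | refl | _ | refl = refl
... | _ ∷ _ | _ | refl | _ | refl = refl

strip-∷ʳ1 : ∀ f → strip (f ++ + 1 ∷ []) ≡ f ++ + 1 ∷ []
strip-∷ʳ1 [] = refl
-- `nonempty` exposes a head, so that `strip` falls into the clause that keeps `a` without
-- inspecting it.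
strip-∷ʳ1 (a ∷ f) with f ++ + 1 ∷ [] | strip (f ++ + 1 ∷ []) | strip-∷ʳ1 f | nonempty f
  where
  nonempty : ∀ (f : Poly) → ∃[ b ] ∃[ g ] f ++ + 1 ∷ [] ≡ b ∷ g
  nonempty []      = _ , _ , refl
  nonempty (b ∷ f) = _ , _ , refl
... | _ | _ | refl | _ , _ , refl = refl

-- Constant coefficient 1 becomes leading coefficient 1 in `reverse f`, so stripping that list loses
-- nothing and a second reversal gives back `f`.
vee-of-reverse : ∀ {f g} → coeff f 0 ≡ + 1 → g ≈ reverse f → vee g ≡ strip f
vee-of-reverse {.(+ 1) ∷ f} {g} refl g≈ = begin
  strip (reverse (strip g))                      ≡⟨ cong (λ h → strip (reverse h)) (strip-cong g≈) ⟩
  strip (reverse (strip (reverse (+ 1 ∷ f))))    ≡⟨ cong (λ h → strip (reverse h)) strip-reverse ⟩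
  strip (reverse (reverse (+ 1 ∷ f)))            ≡⟨ cong strip (reverse-involutive (+ 1 ∷ f)) ⟩
  strip (+ 1 ∷ f)                                ∎
  where
  strip-reverse : strip (reverse (+ 1 ∷ f)) ≡ reverse (+ 1 ∷ f)
  strip-reverse rewrite unfold-reverse (+ 1) f = strip-∷ʳ1 (reverse f)

⊕-∷ʳ : ∀ f g {a b} → length f ≡ length g →
       (f ++ a ∷ []) ⊕ (g ++ b ∷ []) ≡ (f ⊕ g) ++ a ℤ.+ b ∷ []
⊕-∷ʳ []      []      eq = refl
⊕-∷ʳ (a ∷ f) (b ∷ g) eq = cong (_ ∷_) (⊕-∷ʳ f g (ℕₚ.suc-injective eq))

-- `reverse` works with respect to the list length, not the degree; equal lengths keep matching
-- coefficients aligned. This is why 𝒮 and 𝒮′ are padded later.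
reverse-⊕ : ∀ f g → length f ≡ length g → reverse (f ⊕ g) ≡ reverse f ⊕ reverse g
reverse-⊕ []      []      eq = refl
reverse-⊕ (a ∷ f) (b ∷ g) eq = begin
  reverse (a ℤ.+ b ∷ f ⊕ g)                   ≡⟨ unfold-reverse _ (f ⊕ g) ⟩
  reverse (f ⊕ g) ++ a ℤ.+ b ∷ []             ≡⟨ cong (_++ _) (reverse-⊕ f g eq′) ⟩
  (reverse f ⊕ reverse g) ++ a ℤ.+ b ∷ []     ≡⟨ ⊕-∷ʳ (reverse f) (reverse g) (trans (length-reverse f) (trans eq′ (sym (length-reverse g)))) ⟨
  (reverse f ++ a ∷ []) ⊕ (reverse g ++ b ∷ []) ≡⟨ cong₂ _⊕_ (unfold-reverse a f) (unfold-reverse b g) ⟨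
  reverse (a ∷ f) ⊕ reverse (b ∷ g)           ∎
  where
  eq′ = ℕₚ.suc-injective eq

-- The two right-hand sides of the invariant are exchanged by reversal.
reverse-⊕-reverse : ∀ f g → length f ≡ length g → reverse (f ⊕ reverse g) ≡ g ⊕ reverse f
reverse-⊕-reverse f g eq = begin
  reverse (f ⊕ reverse g)           ≡⟨ reverse-⊕ f (reverse g) (trans eq (sym (length-reverse g))) ⟩
  reverse f ⊕ reverse (reverse g)   ≡⟨ cong (reverse f ⊕_) (reverse-involutive g) ⟩
  reverse f ⊕ g                     ≡⟨ ⊕-comm (reverse f) g ⟩
  g ⊕ reverse f                     ∎

-- The invariant linking two negative continued fractions.

-- (A , B) plays the role of (ℛ , 𝒮); b and b′ are 𝒮 and 𝒮′ padded with zeros to a common length,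
-- so that reverse b′ is rev 𝒮′.
record Half (A B b b′ : Poly) : Set where
  field
    R≈  : A ≈ b ⊕ reverse b′
    S≈  : B ≈ b
    R₀  : coeff A 0 ≡ + 1
    S₀  : coeff B 0 ≡ + 1
open Half

record Dual (v v′ : Poly × Poly) : Set where
  field
    b b′    : Poly
    lengths : length b ≡ length b′
    left    : Half (proj₁ v) (proj₂ v) b b′
    right   : Half (proj₁ v′) (proj₂ v′) b′ b

Dual-sym : ∀ {v v′} → Dual v v′ → Dual v′ v
Dual-sym d = record { b = b′ ; b′ = b ; lengths = sym lengths ; left = right ; right = left }
  where open Dual d

-- The invariant writes ℛ and ℛ′ as reversals of each other, and `R₀` supplies the constant term 1
-- that `vee` needs to respect this.
strip≡vee : ∀ {v v′} → Dual v v′ → strip (proj₁ v) ≡ vee (proj₁ v′)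
strip≡vee {v} {v′} d = begin
  strip (proj₁ v)             ≡⟨ strip-cong (R≈ left) ⟩
  strip (b ⊕ reverse b′)      ≡⟨ vee-of-reverse {b ⊕ reverse b′} (trans (sym (at (R≈ left) 0)) (R₀ left)) R′≈ ⟨
  vee (proj₁ v′)              ∎
  where
  open Dual d
  R′≈ : proj₁ v′ ≈ reverse (b ⊕ reverse b′)
  R′≈ = ≈-trans (R≈ right) (≡⇒≈ (sym (reverse-⊕-reverse b b′ lengths)))

-- [k+2]_q r − q^(k+1) s = r + q ([k+1]_q r − q^k s)
applyM-suc : ∀ k r s → proj₁ (applyM (suc (suc k)) (r , s)) ≈ r ⊕ (+ 0 ∷ proj₁ (applyM (suc k) (r , s)))
applyM-suc k r s =
  ≈-trans (⊕-assoc _ (+ 0 ∷ qint (suc k) ⊗ r) (+ 0 ∷ neg (shiftBy k s)))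
          (⊕-cong (≡⇒≈ (map-1* r)) ≈-refl)

applyM-1 : ∀ r s → proj₁ (applyM 1 (r , s)) ≈ r ⊕ neg s
applyM-1 r s = ⊕-cong (≈-trans (⊕-cong (≡⇒≈ (map-1* r)) 0∷[]≈[]) (≡⇒≈ (⊕-identityʳ r))) ≈-refl

coeff₀-applyM-suc : ∀ k r s → coeff (proj₁ (applyM (suc (suc k)) (r , s))) 0 ≡ coeff r 0
coeff₀-applyM-suc k r s =
  trans (at (applyM-suc k r s) 0) (trans (coeff-⊕ r (+ 0 ∷ proj₁ (applyM (suc k) (r , s))) 0) (ℤₚ.+-identityʳ _))

⊕-neg-cancel : ∀ f g → (f ⊕ g) ⊕ neg f ≈ g
⊕-neg-cancel f g = ≈R.begin
  (f ⊕ g) ⊕ neg f    ≈R.≡⟨ cong (_⊕ neg f) (⊕-comm f g) ⟩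
  (g ⊕ f) ⊕ neg f    ≈R.≈⟨ ⊕-assoc g f (neg f) ⟩
  g ⊕ (f ⊕ neg f)    ≈R.≈⟨ ⊕-cong ≈-refl (⊕-inverseʳ f) ⟩
  g ⊕ []             ≈R.≡⟨ ⊕-identityʳ g ⟩
  g                  ≈R.∎
  where module ≈R = ≈-Reasoning

length-⊕ : ∀ f g → length f ≡ length g → length (f ⊕ g) ≡ length f
length-⊕ []      []      eq = refl
length-⊕ (a ∷ f) (b ∷ g) eq = cong suc (length-⊕ f g (ℕₚ.suc-injective eq))

-- Write r for the first component of `v`. On the left, ℛ becomes r + q ℛ, where r is the old 𝒮; on
-- the right, ℛ′ becomes ℛ′ + q (ℛ′ - 𝒮′). The old invariant gives ℛ = rev ℛ′ and ℛ′ - 𝒮′ = rev 𝒮,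
-- which is the new invariant with 𝒮 unchanged and ℛ′ as the new 𝒮′.
Dual-step : ∀ k v v′ → Dual (applyM (suc k) v) v′ → Dual (applyM (suc (suc k)) v) (applyM 2 v′)
Dual-step k v v′ d = record
  -- The extra zero raises the common degree by one, so that reversal produces the factor q of the
  -- recursion.
  { b = b ++ + 0 ∷ []
  ; b′ = a′ ++ + 0 ∷ []
  ; lengths = begin
      length (b ++ + 0 ∷ [])     ≡⟨ length-++ b ⟩
      length b + 1               ≡⟨ cong (_+ 1) (trans (length-⊕ b′ (reverse b) lengths′) (sym lengths)) ⟨
      length a′ + 1              ≡⟨ length-++ a′ ⟨
      length (a′ ++ + 0 ∷ [])    ∎
  ; left = record
    { R≈ = ≈R.begin
        proj₁ (applyM (suc (suc k)) v)                   ≈R.≈⟨ applyM-suc k (proj₁ v) (proj₂ v) ⟩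
        proj₁ v ⊕ (+ 0 ∷ proj₁ (applyM (suc k) v))       ≈R.≈⟨ ⊕-cong S≈b0 (∷-cong R≈reverse) ⟩
        (b ++ + 0 ∷ []) ⊕ (+ 0 ∷ reverse a′)             ≈R.≡⟨ cong ((b ++ + 0 ∷ []) ⊕_) (reverse-++ a′ (+ 0 ∷ [])) ⟨
        (b ++ + 0 ∷ []) ⊕ reverse (a′ ++ + 0 ∷ [])       ≈R.∎
    ; S≈ = S≈b0
    ; R₀ = trans (coeff₀-applyM-suc k (proj₁ v) (proj₂ v)) (S₀ left)
    ; S₀ = S₀ left
    }
  ; right = record
    { R≈ = ≈R.begin
        proj₁ (applyM 2 v′)                              ≈R.≈⟨ applyM-suc 0 (proj₁ v′) (proj₂ v′) ⟩
        proj₁ v′ ⊕ (+ 0 ∷ proj₁ (applyM 1 v′))           ≈R.≈⟨ ⊕-cong R′≈a′0 (∷-cong R′-S′≈) ⟩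
        (a′ ++ + 0 ∷ []) ⊕ (+ 0 ∷ reverse b)             ≈R.≡⟨ cong ((a′ ++ + 0 ∷ []) ⊕_) (reverse-++ b (+ 0 ∷ [])) ⟨
        (a′ ++ + 0 ∷ []) ⊕ reverse (b ++ + 0 ∷ [])       ≈R.∎
    ; S≈ = R′≈a′0
    ; R₀ = trans (coeff₀-applyM-suc 0 (proj₁ v′) (proj₂ v′)) (R₀ right)
    ; S₀ = R₀ right
    }
  }
  where
  module ≈R = ≈-Reasoning
  open Dual d
  a′ = b′ ⊕ reverse b
  lengths′ : length b′ ≡ length (reverse b)
  lengths′ = trans (sym lengths) (sym (length-reverse b))
  S≈b0 : proj₁ v ≈ b ++ + 0 ∷ []
  S≈b0 = ≈-trans (S≈ left) (≈-sym (∷ʳ0≈ b))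
  R≈reverse : proj₁ (applyM (suc k) v) ≈ reverse a′
  R≈reverse = ≈-trans (R≈ left) (≡⇒≈ (sym (reverse-⊕-reverse b′ b (sym lengths))))
  R′≈a′0 : proj₁ v′ ≈ a′ ++ + 0 ∷ []
  R′≈a′0 = ≈-trans (R≈ right) (≈-sym (∷ʳ0≈ a′))
  R′-S′≈ : proj₁ (applyM 1 v′) ≈ reverse b
  R′-S′≈ = ≈R.begin
    proj₁ (applyM 1 v′)          ≈R.≈⟨ applyM-1 (proj₁ v′) (proj₂ v′) ⟩
    proj₁ v′ ⊕ neg (proj₂ v′)    ≈R.≈⟨ ⊕-cong (R≈ right) (neg-cong (S≈ right)) ⟩
    a′ ⊕ neg b′                  ≈R.≈⟨ ⊕-neg-cancel b′ (reverse b) ⟩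
    reverse b                    ≈R.∎

Dual-[2] : Dual (RSof (2 ∷ [])) (RSof (2 ∷ []))
Dual-[2] = record
  -- 𝒮 = 1 is padded to degree one; its reversal is then q, and ℛ = 1 + q.
  { b = + 1 ∷ + 0 ∷ [] ; b′ = + 1 ∷ + 0 ∷ [] ; lengths = refl ; left = half ; right = half }
  where
  half : Half (proj₁ (RSof (2 ∷ []))) (+ 1 ∷ []) (+ 1 ∷ + 0 ∷ []) (+ 1 ∷ + 0 ∷ [])
  half = record { R≈ = ≈-refl ; S≈ = ≈-sym (∷ʳ0≈ (+ 1 ∷ [])) ; R₀ = refl ; S₀ = refl }

-- Negative continued fractions as a relation free of fuel.

-- Each level is a division rounded up. The remainder in `step` is a successor, so remainder zero
-- belongs to `last` alone.
data Expansion : ℕ → ℕ → List ℕ → Set where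
  last : ∀ {x a} k → suc k * a ≡ x → Expansion x a (suc k ∷ [])
  step : ∀ {x a cs} k r → suc k * a ≡ x + suc r → suc r < a →
         Expansion a (suc r) cs → Expansion x a (suc k ∷ cs)

head-suc : ∀ {x a cs} → Expansion x a cs → ∃[ k ] ∃[ ds ] cs ≡ suc k ∷ ds
head-suc (last k _)       = k , _ , refl
head-suc (step k _ _ _ _) = k , _ , refl

Expansion-+ : ∀ {x a k cs} → Expansion x a (suc k ∷ cs) → Expansion (x + a) a (suc (suc k) ∷ cs)
Expansion-+ {x} {a} (last k eq) = last (suc k) (trans (ℕₚ.+-comm a _) (cong (_+ a) eq))
Expansion-+ {x} {a} (step k r eq r<a e) = step (suc k) r (begin
  a + suc k * a        ≡⟨ cong (λ y → a + y) eq ⟩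
  a + (x + suc r)      ≡⟨ ℕₚ.+-assoc a x (suc r) ⟨
  a + x + suc r        ≡⟨ cong (_+ suc r) (ℕₚ.+-comm a x) ⟩
  x + a + suc r        ∎) r<a e

-- (2a - r) / a = 2 - 1 / (a / r). The truncated subtraction is exact because r < a.
Expansion-2 : ∀ {a r cs} → suc r < a → Expansion a (suc r) cs → Expansion (2 * a ∸ suc r) a (2 ∷ cs)
Expansion-2 {a} {r} r<a e =
  step 1 r (sym (ℕₚ.m∸n+n≡m (ℕₚ.≤-trans (ℕₚ.<⇒≤ r<a) (ℕₚ.m≤m+n a (a + 0))))) r<a e

-- If `d < c`, the difference of the two multiples puts a whole `a` into the remainder `r`.
quotient-unique : ∀ {x a r t} c d → c * a ≡ x + r → r < a → d * a ≡ x + t → t < a → c ≤ d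
quotient-unique {x} {a} {r} {t} c d eq r<a eq′ t<a = ℕₚ.≮⇒≥ λ d<c → ℕₚ.<⇒≱ r<a (a≤r d<c)
  where
  a≤r : d < c → a ≤ r
  a≤r d<c = ℕₚ.+-cancelˡ-≤ x a r (≤R.begin
    x + a           ≤R.≤⟨ ℕₚ.+-monoˡ-≤ a (ℕₚ.m≤m+n x t) ⟩
    x + t + a       ≤R.≡⟨ cong (_+ a) eq′ ⟨
    d * a + a       ≤R.≡⟨ ℕₚ.+-comm (d * a) a ⟩
    suc d * a       ≤R.≤⟨ ℕₚ.*-monoˡ-≤ a d<c ⟩
    c * a           ≤R.≡⟨ eq ⟩
    x + r           ≤R.∎)
    where module ≤R = ℕₚ.≤-Reasoning

quotient-remainder-unique : ∀ {x a r t} c d → c * a ≡ x + r → r < a → d * a ≡ x + t → t < a →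
                            c ≡ d × r ≡ t
quotient-remainder-unique {x} c d eq r<a eq′ t<a
  with c≤d ← quotient-unique c d eq r<a eq′ t<a
     | d≤c ← quotient-unique d c eq′ t<a eq r<a
  with refl ← ℕₚ.≤-antisym c≤d d≤c
  = refl , ℕₚ.+-cancelˡ-≡ x _ _ (trans (sym eq) eq′)

-- `last` is treated as remainder zero, which is below `a` by `0 < a`; uniqueness of rounded-up
-- division then settles each level. It identifies expansions built by hand with those computed by
-- `negCF`.
Expansion-unique : ∀ {x a cs ds} → 0 < a → Expansion x a cs → Expansion x a ds → cs ≡ ds
Expansion-unique {x} 0<a (last k eq) (last l eq′)
  with quotient-remainder-unique {x} (suc k) (suc l) (trans eq (sym (ℕₚ.+-identityʳ x))) 0<a (trans eq′ (sym (ℕₚ.+-identityʳ x))) 0<a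
... | refl , _ = refl
Expansion-unique {x} 0<a (last k eq) (step l t eq′ t<a _)
  with quotient-remainder-unique {x} (suc k) (suc l) (trans eq (sym (ℕₚ.+-identityʳ x))) 0<a eq′ t<a
... | _ , ()
Expansion-unique {x} 0<a (step k r eq r<a _) (last l eq′)
  with quotient-remainder-unique {x} (suc k) (suc l) eq r<a (trans eq′ (sym (ℕₚ.+-identityʳ x))) 0<a
... | _ , ()
Expansion-unique {x} 0<a (step k r eq r<a e) (step l t eq′ t<a e′)
  with quotient-remainder-unique {x} (suc k) (suc l) eq r<a eq′ t<a
... | refl , refl = cong (suc k ∷_) (Expansion-unique (s≤s z≤n) e e′)

-- (suc x + a) / suc a is ⌈ suc x / suc a ⌉, so r is the remainder for rounding up.
ceiling-spec : ∀ x a → ∃[ k ] ∃[ r ] ((suc x + a) / suc a ≡ suc k) × (suc k * suc a ≡ suc x + r) × r < suc a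
ceiling-spec x a with (suc x + a) / suc a in eq | m≥n⇒m/n>0 {suc x + a} {suc a} (s≤s (ℕₚ.m≤n+m a x))
... | suc k | _ = k , a ∸ ρ , refl , lemma , s≤s (ℕₚ.m∸n≤m a ρ)
  where
  ρ = (suc x + a) ℕ.% suc a
  ρ≤a : ρ ≤ a
  ρ≤a = ℕₚ.≤-pred (m%n<n (suc x + a) (suc a))
  lemma : suc k * suc a ≡ suc x + (a ∸ ρ)
  lemma = ℕₚ.+-cancelˡ-≡ ρ _ _ (begin
    ρ + suc k * suc a              ≡⟨ cong (λ c → ρ + c * suc a) eq ⟨
    ρ + (suc x + a) / suc a * suc a ≡⟨ m≡m%n+[m/n]*n (suc x + a) (suc a) ⟨
    suc x + a                      ≡⟨ cong (λ y → suc x + y) (ℕₚ.m+[n∸m]≡n ρ≤a) ⟨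
    suc x + (ρ + (a ∸ ρ))          ≡⟨ swap (suc x) ρ (a ∸ ρ) ⟩
    ρ + (suc x + (a ∸ ρ))          ∎)
    where
    swap : ∀ u v w → u + (v + w) ≡ v + (u + w)
    swap = solve-∀

-- `a < f` says that the denominator `suc a` is at most the fuel. Each remainder is smaller than its
-- denominator, so the bound persists.
negCFfuel-expansion : ∀ f x a → a < f → Expansion (suc x) (suc a) (negCFfuel f (suc x) (suc a))
negCFfuel-expansion (suc f) x a (s≤s a≤f) with ceiling-spec x a
... | k , r , q≡ , eq , r<a with suc a * ((suc x + a) / suc a) ∸ suc x | remainder
  where
  remainder : suc a * ((suc x + a) / suc a) ∸ suc x ≡ r
  remainder = begin
    suc a * ((suc x + a) / suc a) ∸ suc x    ≡⟨ cong (λ c → suc a * c ∸ suc x) q≡ ⟩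
    suc a * suc k ∸ suc x                    ≡⟨ cong (_∸ suc x) (trans (ℕₚ.*-comm (suc a) (suc k)) eq) ⟩
    suc x + r ∸ suc x                        ≡⟨ ℕₚ.m+n∸m≡n (suc x) r ⟩
    r                                        ∎
... | zero  | refl = subst (λ c → Expansion (suc x) (suc a) (c ∷ [])) (sym q≡)
                       (last k (trans eq (ℕₚ.+-identityʳ (suc x))))
... | suc r | refl = subst (λ c → Expansion (suc x) (suc a) (c ∷ negCFfuel f (suc a) (suc r))) (sym q≡)
                       (step k r eq r<a (negCFfuel-expansion f a r (ℕₚ.<-≤-trans (ℕₚ.≤-pred r<a) a≤f)))

negCF-expansion : ∀ x a → Expansion (suc x) (suc a) (negCF (suc x) (suc a))
negCF-expansion x a = negCFfuel-expansion (suc a) x a ℕₚ.≤-refl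

-- Complementary fractions by the subtractive Euclidean algorithm.

DualExpansions : ℕ → ℕ → Set
DualExpansions r s = ∃[ cs ] ∃[ ds ]
  Expansion (r + s) r cs × Expansion (r + s) s ds × Dual (RSof cs) (RSof ds)

DualExpansions-sym : ∀ {r s} → DualExpansions r s → DualExpansions s r
DualExpansions-sym {r} {s} (cs , ds , e , e′ , d) =
  ds , cs , subst (λ x → Expansion x s ds) (ℕₚ.+-comm r s) e′ ,
  subst (λ x → Expansion x r cs) (ℕₚ.+-comm r s) e , Dual-sym d

-- With r and t for the positive arguments, (2r + t) / r = 1 + (r + t) / r raises the first
-- coefficient, while (2r + t) / (r + t) = 2 - t / (r + t) acquires a leading 2.
DualExpansions-+ : ∀ {r t} → DualExpansions (suc r) (suc t) → DualExpansions (suc r) (suc r + suc t)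
DualExpansions-+ {r} {t} (_ , ds , e , e′ , d) with head-suc e
... | k , cs , refl =
  suc (suc k) ∷ cs , 2 ∷ ds ,
  subst (λ x → Expansion x (suc r) (suc (suc k) ∷ cs)) (ℕₚ.+-comm (suc r + suc t) (suc r)) (Expansion-+ e) ,
  subst (λ x → Expansion x (suc r + suc t) (2 ∷ ds)) two-minus (Expansion-2 (ℕₚ.m<n+m (suc t) (s≤s z≤n)) e′) ,
  Dual-step k (RSof cs) (RSof ds) d
  where
  regroup : ∀ r t → 2 * (r + t) ≡ r + (r + t) + t
  regroup = solve-∀
  two-minus : 2 * (suc r + suc t) ∸ suc t ≡ suc r + (suc r + suc t)
  two-minus = trans (cong (_∸ suc t) (regroup (suc r) (suc t))) (ℕₚ.m+n∸n≡m _ (suc t))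

-- Induction on a bound for `r + s`: the smaller argument is subtracted from the larger until both
-- agree, where both fractions equal 2.
dualExpansions : ∀ n r s → r + s < n → DualExpansions (suc r) (suc s)
dualExpansions (suc n) r s (s≤s r+s≤n) with ℕₚ.<-cmp r s
... | tri≈ _ refl _ = 2 ∷ [] , 2 ∷ [] , last 1 (double (suc r)) , last 1 (double (suc r)) , Dual-[2]
  where
  double : ∀ m → 2 * m ≡ m + m
  double = solve-∀
... | tri< r<s _ _ with ℕₚ.m≤n⇒∃[o]m+o≡n r<s
-- Here s + 1 = (r + 1) + (t + 1), so subtraction leaves the pair (r + 1, t + 1).
...   | t , refl = subst (DualExpansions (suc r)) (cong suc (ℕₚ.+-suc r t))
        (DualExpansions-+ (dualExpansions n r t (ℕₚ.<-≤-trans (ℕₚ.+-monoʳ-< r (s≤s (ℕₚ.m≤n+m t r))) r+s≤n)))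
dualExpansions (suc n) r s (s≤s r+s≤n) | tri> _ _ s<r with ℕₚ.m≤n⇒∃[o]m+o≡n s<r
...   | t , refl = DualExpansions-sym (subst (DualExpansions (suc s)) (cong suc (ℕₚ.+-suc s t))
        (DualExpansions-+ (dualExpansions n s t (ℕₚ.<-≤-trans (s≤s (subst (s + t ≤_) (ℕₚ.+-comm s (s + t)) (ℕₚ.m≤n+m (s + t) s))) r+s≤n))))

-- Reflection for numerators whose sum is a multiple of the denominator.

-- `r + t` equals (k + l - m) D and lies strictly between 0 and 2D.
sum-of-remainders : ∀ {D x y} m k l r t → x + y ≡ m * D → k * D ≡ x + r → l * D ≡ y + t →
                    r < D → t < D → 0 < r + t → r + t ≡ D
sum-of-remainders {D} {x} {y} m k l r t eq eqr eqt r<D t<D 0<r+t =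
  single (proj₁ excess) (multiple (proj₁ excess) (proj₂ excess))
  where
  module ≤R = ℕₚ.≤-Reasoning
  interchange : ∀ a b c d → a + b + (c + d) ≡ (a + c) + (b + d)
  interchange = solve-∀
  total : x + y + (r + t) ≡ (k + l) * D
  total = begin
    x + y + (r + t)        ≡⟨ interchange x y r t ⟩
    (x + r) + (y + t)      ≡⟨ cong₂ _+_ eqr eqt ⟨
    k * D + l * D          ≡⟨ ℕₚ.*-distribʳ-+ D k l ⟨
    (k + l) * D            ∎
  m≤k+l : m ≤ k + l
  m≤k+l = ℕₚ.≮⇒≥ λ k+l<m → ℕₚ.<⇒≱ 0<r+t (ℕₚ.+-cancelˡ-≤ (x + y) _ _ (≤R.begin
    x + y + (r + t)        ≤R.≡⟨ total ⟩
    (k + l) * D            ≤R.≤⟨ ℕₚ.*-monoˡ-≤ D (ℕₚ.<⇒≤ k+l<m) ⟩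
    m * D                  ≤R.≡⟨ trans (ℕₚ.+-identityʳ (x + y)) eq ⟨
    x + y + 0              ≤R.∎))
  excess : ∃[ o ] m + o ≡ k + l
  excess = ℕₚ.m≤n⇒∃[o]m+o≡n m≤k+l
  multiple : ∀ o → m + o ≡ k + l → r + t ≡ o * D
  multiple o m+o≡k+l = ℕₚ.+-cancelˡ-≡ (x + y) _ _ (begin
    x + y + (r + t)        ≡⟨ total ⟩
    (k + l) * D            ≡⟨ cong (_* D) m+o≡k+l ⟨
    (m + o) * D            ≡⟨ ℕₚ.*-distribʳ-+ D m o ⟩
    m * D + o * D          ≡⟨ cong (_+ o * D) eq ⟨
    x + y + o * D          ∎)
  single : ∀ o → r + t ≡ o * D → r + t ≡ D
  single zero          e = ⊥-elim (ℕₚ.<-irrefl (sym e) 0<r+t)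
  single (suc zero)    e = trans e (ℕₚ.+-identityʳ D)
  single (suc (suc o)) e = ⊥-elim (ℕₚ.<-irrefl e (ℕₚ.<-≤-trans (ℕₚ.+-mono-< r<D t<D)
    (ℕₚ.+-monoʳ-≤ D (ℕₚ.m≤m+n D (o * D)))))

-- The second component of `applyM` is the old first one, so 𝒮 of the whole expansion is ℛ of its
-- tail. The tails expand D / r and D / t with r + t = D.
expansions-dual : ∀ {x y d m cs ds} → x + y ≡ m * suc d → Expansion x (suc d) cs → Expansion y (suc d) ds →
                  strip (proj₂ (RSof cs)) ≡ vee (proj₂ (RSof ds))
expansions-dual eq (last k _) (last l _) = refl
-- A zero remainder beside a nonzero one is impossible: the nonzero one would have to equal the
-- denominator.
expansions-dual {x} {y} {m = m} eq (last k eqx) (step l t eqy t<D _) =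
  ⊥-elim (ℕₚ.<-irrefl
    (sum-of-remainders {x = x} {y} m (suc k) (suc l) 0 (suc t) eq (trans eqx (sym (ℕₚ.+-identityʳ x))) eqy (s≤s z≤n) t<D (s≤s z≤n))
    t<D)
expansions-dual {x} {y} {m = m} eq (step k r eqx r<D _) (last l eqy) =
  ⊥-elim (ℕₚ.<-irrefl
    (trans (sym (ℕₚ.+-identityʳ (suc r)))
      (sum-of-remainders {x = x} {y} m (suc k) (suc l) (suc r) 0 eq eqx (trans eqy (sym (ℕₚ.+-identityʳ y))) r<D (s≤s z≤n) (s≤s z≤n)))
    r<D)
expansions-dual {x} {y} {m = m} eq (step k r eqx r<D e) (step l t eqy t<D e′)
  with sum-of-remainders {x = x} {y} m (suc k) (suc l) (suc r) (suc t) eq eqx eqy r<D t<D (s≤s z≤n)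
... | refl with dualExpansions (suc (r + t)) r t ℕₚ.≤-refl
... | cs , ds , f , f′ , dual with Expansion-unique (s≤s z≤n) e f | Expansion-unique (s≤s z≤n) e′ f′
... | refl | refl = strip≡vee dual

Sgt-dual : ∀ x y d m → suc x + suc y ≡ m * suc d → strip (Sgt (suc x) (suc d)) ≡ vee (Sgt (suc y) (suc d))
Sgt-dual x y d m eq = expansions-dual {m = m} eq (negCF-expansion x d) (negCF-expansion y d)

-- Integer translates of rational numbers.

1-coprime : ∀ n → Coprime n 1
1-coprime n = Coprimality.sym (1-coprimeTo n)

ι≡mkℚ : ∀ z → ι z ≡ mkℚ z 0 (1-coprime ℤ.∣ z ∣)
ι≡mkℚ z = ℚₚ.↥p/↧p≡p (mkℚ z 0 (1-coprime ℤ.∣ z ∣))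

coprime-shift : ∀ n m D → Coprime ℤ.∣ n ∣ D → Coprime ℤ.∣ n ℤ.+ m ℤ.* + D ∣ D
coprime-shift n m D c {i} (i∣n+mD , i∣D) =
  c (∣⇒∣ᵤ (∣m+n∣n⇒∣m {+ i} {n} (∣ᵤ⇒∣ i∣n+mD) (∣n⇒∣m*n m (∣ᵤ⇒∣ i∣D))) , i∣D)

-- Translation by an integer preserves lowest terms, so normalisation changes nothing and the
-- denominator stays the same.
+-ι : ∀ n d .(c : Coprime ℤ.∣ n ∣ (suc d)) m →
      mkℚ n d c ℚ.+ ι m ≡ mkℚ (n ℤ.+ m ℤ.* + suc d) d (coprime-shift n m (suc d) (recompute c))
+-ι n d c m = begin
  mkℚ n d c ℚ.+ ι m                                 ≡⟨ cong (λ r → mkℚ n d c ℚ.+ r) (ι≡mkℚ m) ⟩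
  mkℚ n d c ℚ.+ mkℚ m 0 (1-coprime ℤ.∣ m ∣)         ≡⟨ ℚₚ./-cong (cong (λ z → z ℤ.+ m ℤ.* + suc d) (ℤₚ.*-identityʳ n)) (ℕₚ.*-identityʳ (suc d)) ⟩
  (n ℤ.+ m ℤ.* + suc d) ℚ./ suc d                   ≡⟨ ℚₚ.↥p/↧p≡p (mkℚ (n ℤ.+ m ℤ.* + suc d) d (coprime-shift n m (suc d) (recompute c))) ⟩
  mkℚ (n ℤ.+ m ℤ.* + suc d) d _                     ∎

↥-+-ι : ∀ p m → ↥ (p ℚ.+ ι m) ≡ ↥ p ℤ.+ m ℤ.* ↧ p
↥-+-ι (mkℚ n d c) m = cong ↥_ (+-ι n d c m)

↧ₙ-+-ι : ∀ p m → ↧ₙ (p ℚ.+ ι m) ≡ ↧ₙ p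
↧ₙ-+-ι (mkℚ n d c) m = cong ↧ₙ_ (+-ι n d c m)

ι-+ : ∀ a b → ι a ℚ.+ ι b ≡ ι (a ℤ.+ b)
ι-+ a b = begin
  ι a ℚ.+ ι b                                ≡⟨ cong (λ r → r ℚ.+ ι b) (ι≡mkℚ a) ⟩
  mkℚ a 0 (1-coprime ℤ.∣ a ∣) ℚ.+ ι b        ≡⟨ +-ι a 0 (1-coprime ℤ.∣ a ∣) b ⟩
  mkℚ (a ℤ.+ b ℤ.* + 1) 0 _                  ≡⟨ ι≡mkℚ (a ℤ.+ b ℤ.* + 1) ⟨
  ι (a ℤ.+ b ℤ.* + 1)                        ≡⟨ cong (λ z → ι (a ℤ.+ z)) (ℤₚ.*-identityʳ b) ⟩
  ι (a ℤ.+ b)                                ∎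

ι-neg : ∀ a → ι (ℤ.- a) ≡ ℚ.- ι a
ι-neg a = begin
  ι (ℤ.- a)                          ≡⟨ ℚₚ.+-identityʳ _ ⟨
  ι (ℤ.- a) ℚ.+ 0ℚ                   ≡⟨ cong (λ r → ι (ℤ.- a) ℚ.+ r) (ℚₚ.+-inverseʳ (ι a)) ⟨
  ι (ℤ.- a) ℚ.+ (ι a ℚ.- ι a)        ≡⟨ ℚₚ.+-assoc (ι (ℤ.- a)) (ι a) _ ⟨
  ι (ℤ.- a) ℚ.+ ι a ℚ.- ι a          ≡⟨ cong (λ r → r ℚ.- ι a) (trans (ι-+ (ℤ.- a) a) (cong ι (ℤₚ.+-inverseˡ a))) ⟩
  0ℚ ℚ.- ι a                         ≡⟨ ℚₚ.+-identityˡ _ ⟩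
  ℚ.- ι a                            ∎

*-ι-↧ : ∀ p → p ℚ.* ι (↧ p) ≡ ι (↥ p)
*-ι-↧ p@(mkℚ n d c) = begin
  p ℚ.* ι (+ suc d)                                    ≡⟨ cong (λ r → p ℚ.* r) (ι≡mkℚ (+ suc d)) ⟩
  (n ℤ.* + suc d) ℚ./ (suc d ℕ.* 1)                    ≡⟨ ℚₚ.fromℚᵘ-cong {ℚᵘ.mkℚᵘ (n ℤ.* + suc d) (d ℕ.* 1)} {ℚᵘ.mkℚᵘ n 0} (ℚᵘ.*≡* cross) ⟩
  ι n                                                  ∎
  where
  cross : n ℤ.* + suc d ℤ.* + 1 ≡ n ℤ.* + suc (d ℕ.* 1)
  cross = trans (ℤₚ.*-identityʳ _) (cong (λ e → n ℤ.* + suc e) (sym (ℕₚ.*-identityʳ d)))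

*-inv : ∀ p → p ≢ 0ℚ → p ℚ.* inv p ≡ 1ℚ
*-inv (mkℚ (+ 0) d c)        p≢0 = ⊥-elim (p≢0 (ℚₚ.↥p≡0⇒p≡0 (mkℚ (+ 0) d c) refl))
*-inv p@(mkℚ ℤ.+[1+ n ] d c) p≢0 = ℚₚ.*-inverseʳ p
*-inv p@(mkℚ ℤ.-[1+ n ] d c) p≢0 = ℚₚ.*-inverseʳ p

floor-spec : ∀ p → ∃[ ρ ] ρ < ↧ₙ p × (↥ p ≡ + ρ ℤ.+ ℚ.floor p ℤ.* ↧ p)
floor-spec p@(mkℚ n d c) = n ℤ.% + suc d , n%d<d n (+ suc d) , a≡a%n+[a/n]*n n (+ suc d)

ceiling-spec-ℚ : ∀ p → ∃[ x ] ↥ p ℤ.+ (+ 2 ℤ.- ℚ.ceiling p) ℤ.* ↧ p ≡ + suc x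
ceiling-spec-ℚ p@(mkℚ n d c) with floor-spec (ℚ.- p)
... | ρ , ρ<D , -n≡ with ℕₚ.m≤n⇒∃[o]m+o≡n (subst (ρ <_) (ℤₚ.+-injective (ℚₚ.↧-neg p)) ρ<D)
-- Since ⌈p⌉ = -⌊-p⌋ and D = ρ + o + 1, the shifted numerator is 2D - ρ = D + (o + 1), hence
-- positive.
... | o , refl = ρ + o + suc o , (begin
  n ℤ.+ (+ 2 ℤ.- ℤ.- f) ℤ.* + suc (ρ + o)                                       ≡⟨ regroup n f (+ suc (ρ + o)) ⟩
  ℤ.- (ℤ.- n) ℤ.+ (+ 2 ℤ.+ f) ℤ.* + suc (ρ + o)                                 ≡⟨ cong (λ z → ℤ.- z ℤ.+ (+ 2 ℤ.+ f) ℤ.* + suc (ρ + o)) -n≡′ ⟩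
  ℤ.- (+ ρ ℤ.+ f ℤ.* + suc (ρ + o)) ℤ.+ (+ 2 ℤ.+ f) ℤ.* + suc (ρ + o)           ≡⟨ cancel f (+ ρ) (+ o) ⟩
  + suc (ρ + o) ℤ.+ + suc o                                                     ∎)
  where
  f = ℚ.floor (ℚ.- p)
  -n≡′ : ℤ.- n ≡ + ρ ℤ.+ f ℤ.* + suc (ρ + o)
  -n≡′ = trans (sym (ℚₚ.↥-neg p)) (trans -n≡ (cong (λ z → + ρ ℤ.+ f ℤ.* z) (ℚₚ.↧-neg p)))
  regroup : ∀ n f D → n ℤ.+ (+ 2 ℤ.- ℤ.- f) ℤ.* D ≡ ℤ.- (ℤ.- n) ℤ.+ (+ 2 ℤ.+ f) ℤ.* D
  regroup = solve-ℤ-∀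
  cancel : ∀ f ρ o → ℤ.- (ρ ℤ.+ f ℤ.* (+ 1 ℤ.+ (ρ ℤ.+ o))) ℤ.+ (+ 2 ℤ.+ f) ℤ.* (+ 1 ℤ.+ (ρ ℤ.+ o))
                     ≡ (+ 1 ℤ.+ (ρ ℤ.+ o)) ℤ.+ (+ 1 ℤ.+ o)
  cancel = solve-ℤ-∀

1<⇒↧<↥ : ∀ {p} → 1ℚ ℚ.< p → ↧ p ℤ.< ↥ p
1<⇒↧<↥ {p} (*<* 1<p) = subst₂ ℤ._<_ (ℤₚ.*-identityˡ (↧ p)) (ℤₚ.*-identityʳ (↥ p)) 1<p

-- Reflection for 𝒮 on all rational numbers.

-- Both branches of `𝒮` evaluate `Sgt` at a positive numerator congruent to `↥ p` modulo `↧ p`.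
-- Which translate is taken does not matter for `Sgt-dual`.
𝒮-representative : ∀ p → ∃[ x ] ∃[ j ] 𝒮 p ≡ Sgt (suc x) (↧ₙ p) × (+ suc x ≡ ↥ p ℤ.+ j ℤ.* ↧ p)
𝒮-representative p with 1ℚ ℚₚ.<? p
... | yes 1<p with ↥ p | ℤₚ.<-trans (ℤ.+<+ (s≤s z≤n)) (1<⇒↧<↥ 1<p)
...   | + suc x | _ = x , + 0 , refl , sym (ℤₚ.+-identityʳ _)
...   | + zero  | ℤ.+<+ ()
𝒮-representative p | no _ with ceiling-spec-ℚ p
...   | x , eq = x , j , cong₂ Sgt (cong ℤ.∣_∣ (trans (↥-+-ι p j) eq)) (↧ₙ-+-ι p j) , sym eq
  where
  j = + 2 ℤ.- ℚ.ceiling p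

𝒮-reflection : ∀ p m → strip (𝒮 p) ≡ vee (𝒮 (ℚ.- p ℚ.+ ι m))
𝒮-reflection p m with 𝒮-representative p | 𝒮-representative (ℚ.- p ℚ.+ ι m)
... | x , j , 𝒮≡ , x≡ | y , l , 𝒮′≡ , y≡ = begin
  strip (𝒮 p)                       ≡⟨ cong strip 𝒮≡ ⟩
  -- The multiplier is positive, as the sum and the denominator are; the absolute value only moves
  -- it into ℕ.
  strip (Sgt (suc x) (↧ₙ p))        ≡⟨ Sgt-dual x y (ℚ.denominator-1 p) ℤ.∣ j ℤ.+ m ℤ.+ l ∣ sum≡ ⟩
  vee (Sgt (suc y) (↧ₙ p))          ≡⟨ cong (λ D → vee (Sgt (suc y) D)) ↧ₙ≡ ⟨
  vee (Sgt (suc y) (↧ₙ p′))         ≡⟨ cong vee 𝒮′≡ ⟨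
  vee (𝒮 p′)                        ∎
  where
  p′ = ℚ.- p ℚ.+ ι m
  ↧ₙ≡ : ↧ₙ p′ ≡ ↧ₙ p
  ↧ₙ≡ = trans (↧ₙ-+-ι (ℚ.- p) m) (ℤₚ.+-injective (ℚₚ.↧-neg p))
  ↥≡ : ↥ p′ ≡ ℤ.- ↥ p ℤ.+ m ℤ.* ↧ p
  ↥≡ = trans (↥-+-ι (ℚ.- p) m) (cong₂ (λ n D → n ℤ.+ m ℤ.* D) (ℚₚ.↥-neg p) (ℚₚ.↧-neg p))
  regroup : ∀ n D j m l → (n ℤ.+ j ℤ.* D) ℤ.+ (ℤ.- n ℤ.+ m ℤ.* D ℤ.+ l ℤ.* D) ≡ (j ℤ.+ m ℤ.+ l) ℤ.* D
  regroup = solve-ℤ-∀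
  sumℤ≡ : + (suc x + suc y) ≡ (j ℤ.+ m ℤ.+ l) ℤ.* ↧ p
  sumℤ≡ = begin
    + suc x ℤ.+ + suc y                                                      ≡⟨ cong₂ ℤ._+_ x≡ y≡ ⟩
    (↥ p ℤ.+ j ℤ.* ↧ p) ℤ.+ (↥ p′ ℤ.+ l ℤ.* + ↧ₙ p′)                         ≡⟨ cong₂ (λ n D → (↥ p ℤ.+ j ℤ.* ↧ p) ℤ.+ (n ℤ.+ l ℤ.* + D)) ↥≡ ↧ₙ≡ ⟩
    (↥ p ℤ.+ j ℤ.* ↧ p) ℤ.+ (ℤ.- ↥ p ℤ.+ m ℤ.* ↧ p ℤ.+ l ℤ.* ↧ p)            ≡⟨ regroup (↥ p) (↧ p) j m l ⟩
    (j ℤ.+ m ℤ.+ l) ℤ.* ↧ p                                                  ∎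
  sum≡ : suc x + suc y ≡ ℤ.∣ j ℤ.+ m ℤ.+ l ∣ * ↧ₙ p
  sum≡ = trans (cong ℤ.∣_∣ sumℤ≡) (ℤₚ.abs-* (j ℤ.+ m ℤ.+ l) (↧ p))

-- The argument on the right as an integer minus `𝔦 α`.

module _ (α : ℚ) (1<α : 1ℚ ℚ.< α) where

  private
    t = α ℚ.- 1ℚ
    w = ι (↧ α)
    u = ι (↥ α ℤ.- ↧ α)

  u≡tw : u ≡ t ℚ.* w
  u≡tw = begin
    ι (↥ α ℤ.- ↧ α)              ≡⟨ ι-+ (↥ α) (ℤ.- ↧ α) ⟨
    ι (↥ α) ℚ.+ ι (ℤ.- ↧ α)      ≡⟨ cong₂ ℚ._+_ (sym (*-ι-↧ α)) (ι-neg (↧ α)) ⟩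
    α ℚ.* w ℚ.- w                ≡⟨ solve 2 (λ a w → a :* w :- w := (a :- con 1ℚ) :* w) refl α w ⟩
    t ℚ.* w                      ∎
    where open +-*-Solver

  u≢0 : u ≢ 0ℚ
  u≢0 u≡0 = ℤₚ.<-irrefl (sym (ℤₚ.i-j≡0⇒i≡j (↥ α) (↧ α) (cong ↥_ (trans (sym (ι≡mkℚ _)) u≡0)))) (1<⇒↧<↥ 1<α)

  t≢0 : t ≢ 0ℚ
  t≢0 t≡0 = u≢0 (trans u≡tw (trans (cong (λ r → r ℚ.* w) t≡0) (ℚₚ.*-zeroˡ w)))

  -- From `u ≡ t ℚ.* w` with `u` nonzero; this cancels the common denominator of x and x - a in `𝔦`.
  inv-t≡ : inv t ≡ w ℚ.* inv u
  inv-t≡ = begin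
    inv t                                ≡⟨ ℚₚ.*-identityʳ _ ⟨
    inv t ℚ.* 1ℚ                         ≡⟨ cong (λ r → inv t ℚ.* r) (*-inv u u≢0) ⟨
    inv t ℚ.* (u ℚ.* inv u)              ≡⟨ cong (λ r → inv t ℚ.* (r ℚ.* inv u)) u≡tw ⟩
    inv t ℚ.* (t ℚ.* w ℚ.* inv u)        ≡⟨ solve 4 (λ i t w v → i :* (t :* w :* v) := t :* i :* (w :* v)) refl (inv t) t w (inv u) ⟩
    t ℚ.* inv t ℚ.* (w ℚ.* inv u)        ≡⟨ cong (λ r → r ℚ.* (w ℚ.* inv u)) (*-inv t t≢0) ⟩
    1ℚ ℚ.* (w ℚ.* inv u)                 ≡⟨ ℚₚ.*-identityˡ _ ⟩
    w ℚ.* inv u                          ∎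
    where open +-*-Solver

  𝔦≡ : 𝔦 α ≡ α ÷′ t
  𝔦≡ = begin
    ι (↥ α) ℚ.* inv u            ≡⟨ cong (λ r → r ℚ.* inv u) (*-ι-↧ α) ⟨
    α ℚ.* w ℚ.* inv u            ≡⟨ ℚₚ.*-assoc α w (inv u) ⟩
    α ℚ.* (w ℚ.* inv u)          ≡⟨ cong (λ r → α ℚ.* r) inv-t≡ ⟨
    α ℚ.* inv t                  ∎

  -- α - 2 = 2 (α - 1) - α, so division by α - 1 leaves k + 2 - α / (α - 1).
  complement-𝔦 : ∀ k → (ι k ℚ.* t ℚ.+ α ℚ.- ι (+ 2)) ÷′ t ≡ ℚ.- 𝔦 α ℚ.+ ι (k ℤ.+ + 2)
  complement-𝔦 k = begin
    (ι k ℚ.* t ℚ.+ α ℚ.- ι (+ 2)) ℚ.* inv t                  ≡⟨ solve 3 (λ κ a i → (κ :* (a :- con 1ℚ) :+ a :- con (ι (+ 2))) :* i := :- (a :* i) :+ (κ :+ con (ι (+ 2))) :* ((a :- con 1ℚ) :* i)) refl (ι k) α (inv t) ⟩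
    ℚ.- (α ℚ.* inv t) ℚ.+ (ι k ℚ.+ ι (+ 2)) ℚ.* (t ℚ.* inv t) ≡⟨ cong (λ r → ℚ.- (α ℚ.* inv t) ℚ.+ (ι k ℚ.+ ι (+ 2)) ℚ.* r) (*-inv t t≢0) ⟩
    ℚ.- (α ℚ.* inv t) ℚ.+ (ι k ℚ.+ ι (+ 2)) ℚ.* 1ℚ           ≡⟨ cong₂ (λ r s → ℚ.- r ℚ.+ s) (sym 𝔦≡) (trans (ℚₚ.*-identityʳ _) (ι-+ k (+ 2))) ⟩
    ℚ.- 𝔦 α ℚ.+ ι (k ℤ.+ + 2)                                ∎
    where open +-*-Solver

  𝒮-𝔦 : ∀ k → strip (𝒮 (𝔦 α)) ≡ vee (𝒮 ((ι k ℚ.* t ℚ.+ α ℚ.- ι (+ 2)) ÷′ t))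
  𝒮-𝔦 k = trans (𝒮-reflection (𝔦 α) (k ℤ.+ + 2)) (cong (λ r → vee (𝒮 r)) (sym (complement-𝔦 k)))

theorem5p4 : (α : ℚ) → 1ℚ ℚ.< α →
    (a₁ : ℤ) (as : List ℕ) → All (λ b → 1 ℕ.≤ b) as → cfVal a₁ as ≡ α →
    (a₁ ≡ + 1 → (a₂ : ℕ) (rest : List ℕ) → as ≡ a₂ ∷ rest →
    strip (𝒮 (𝔦 α))
    ≡ vee (𝒮 ((((ι (+ a₂) ℚ.+ 1ℚ) ℚ.* (α ℚ.- 1ℚ)) ℚ.+ α ℚ.- ι (+ 2)) ÷′ (α ℚ.- 1ℚ))))
    × (+ 2 ℤ.≤ a₁ →
    strip (𝒮 (𝔦 α))
    ≡ vee (𝒮 (((ι a₁ ℚ.* (α ℚ.- 1ℚ)) ℚ.+ α ℚ.- ι (+ 2)) ÷′ (α ℚ.- 1ℚ))))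
theorem5p4 α 1<α a₁ as _ _ =
  -- The instance k = a₂ + 1, with the sum taken inside `ι`; the other part is k = a₁.
  (λ _ a₂ _ _ → subst (λ κ → strip (𝒮 (𝔦 α)) ≡ vee (𝒮 ((κ ℚ.* (α ℚ.- 1ℚ) ℚ.+ α ℚ.- ι (+ 2)) ÷′ (α ℚ.- 1ℚ))))
                  (sym (ι-+ (+ a₂) (+ 1))) (𝒮-𝔦 α 1<α (+ a₂ ℤ.+ + 1))) ,
  (λ _ → 𝒮-𝔦 α 1<α a₁)
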